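{- For any integers $k\geq 1$ and $m\geq 2$, the graph $C_{4k}\times P_m$ admits a $2(2m-1)$-divisible graceful $\alpha$-labeling.
   Context: $C_n$ ($n\ge 3$) is the cycle on $n$ vertices and $P_m$ ($m\ge 2$) is the path on $m$ vertices. $C_n\times P_m$ denotes their Cartesian product (the grid on a cylinder): its vertices are the pairs $(i,j)$ with $1\le i\le m$, $1\le j\le n$, and its edges are $[(i,j),(i,j+1)]$ (with $j$ taken modulo $n$) for $1\le i\le m$, and $[(i,j),(i+1,j)]$ for $1\le i\le m-1$. The graph $C_{4k}\times P_m$ is bipartite and has $4k(2m-1)$ edges. The size of a graph is its number of edges. Let $\Gamma$ be a graph of size $e=d\cdot q$ with $d,q$ positive integers. A $d$-divisible graceful labeling of $\Gamma$ is an injective function $f:V(\Gamma)\to\{0,1,2,\ldots,d(q+1)-1\}$ such that $$\{|f(x)-f(y)| : [x,y]\in E(\Gamma)\}=\{1,2,3,\ldots,d(q+1)\}\setminus\{q+1,2(q+1),\ldots,d(q+1)\}.$$ If $\Gamma$ is bipartite, a $d$-divisible graceful $\alpha$-labeling of $\Gamma$ is a $d$-divisible graceful labeling $f$ of $\Gamma$ such that the maximum value of $f$ on one of the two bipartite sets is strictly less than its minimum value on the other one. -}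

module Defs where

open import Data.Bool.Base using (Bool; not)
open import Data.Fin.Base using (Fin; toℕ)
open import Data.Nat.Base using (ℕ; suc; _+_; _*_; _≤_; _<_; z≤n; s≤s; ∣_-_∣)
open import Data.Nat.Properties using (≤-trans; *-monoʳ-≤; 1+n≢n)
open import Data.Product.Base using (Σ; ∃; ∃-syntax; _×_; _,_; proj₁; proj₂)
open import Data.Sum.Base using (_⊎_; inj₁; inj₂; swap)
open import Function.Bundles using (Bijection)
open import Function.Definitions using (Injective)
open import Level using (0ℓ)
open import Relation.Binary.Bundles using (Setoid)
open import Relation.Binary.Definitions using (Symmetric)
open import Relation.Binary.PropositionalEquality
  using (_≡_; _≢_; refl; sym; trans; cong; setoid)
open import Relation.Nullary.Negation.Core using (¬_)
open import Relation.Unary using (Pred; _∈_; _≐_; _∖_)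

record Graph : Set₁ where
  field
    V          : Set
    Adj        : V → V → Set
    adj-sym    : Symmetric Adj
    adj-irrefl : ∀ {x} → ¬ Adj x x

-- Edges are unordered: an edge is an adjacent ordered pair, considered up to
-- exchanging its endpoints (and regardless of the proof of adjacency).

module _ (Γ : Graph) where
  open Graph Γ

  Edge : Set
  Edge = Σ (V × V) λ p → Adj (proj₁ p) (proj₂ p)

  _≈ₑ_ : Edge → Edge → Set
  ((x , y) , _) ≈ₑ ((x′ , y′) , _) = (x ≡ x′ × y ≡ y′) ⊎ (x ≡ y′ × y ≡ x′)

  private
    ≈ₑ-sym : Symmetric _≈ₑ_
    ≈ₑ-sym (inj₁ (refl , refl)) = inj₁ (refl , refl)
    ≈ₑ-sym (inj₂ (refl , refl)) = inj₂ (refl , refl)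

    ≈ₑ-trans : ∀ {a b c} → a ≈ₑ b → b ≈ₑ c → a ≈ₑ c
    ≈ₑ-trans (inj₁ (refl , refl)) q                    = q
    ≈ₑ-trans (inj₂ (refl , refl)) (inj₁ (refl , refl)) = inj₂ (refl , refl)
    ≈ₑ-trans (inj₂ (refl , refl)) (inj₂ (refl , refl)) = inj₁ (refl , refl)

  edgeSetoid : Setoid 0ℓ 0ℓ
  edgeSetoid = record
    { Carrier       = Edge
    ; _≈_           = _≈ₑ_
    ; isEquivalence = record
      { refl  = inj₁ (refl , refl)
      ; sym   = λ {a} {b} → ≈ₑ-sym {a} {b}
      ; trans = λ {a} {b} {c} → ≈ₑ-trans {a} {b} {c}
      }
    }

  HasSize : ℕ → Set
  HasSize e = Bijection (setoid (Fin e)) edgeSetoid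

-- Vertices of paths and cycles are numbered from 0.

P : ℕ → Graph
P m = record
  { V          = Fin m
  ; Adj        = λ x y → toℕ y ≡ suc (toℕ x) ⊎ toℕ x ≡ suc (toℕ y)
  ; adj-sym    = swap
  ; adj-irrefl = λ { (inj₁ e) → 1+n≢n (sym e) ; (inj₂ e) → 1+n≢n (sym e) }
  }

-- y is x + 1 modulo n.
Next : ∀ {n} → Fin n → Fin n → Set
Next {n} x y = toℕ y ≡ suc (toℕ x) ⊎ (suc (toℕ x) ≡ n × toℕ y ≡ 0)

private
  ¬Next-refl : ∀ {n} → 3 ≤ n → {x : Fin n} → ¬ Next x x
  ¬Next-refl _ (inj₁ e) = 1+n≢n (sym e)
  ¬Next-refl n≥3 (inj₂ (e , z)) = absurd n≥3 (trans (sym e) (cong suc z))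
    where
    absurd : ∀ {a} → 3 ≤ a → a ≢ 1
    absurd (s≤s ()) refl

C : (n : ℕ) → 3 ≤ n → Graph
C n n≥3 = record
  { V          = Fin n
  ; Adj        = λ x y → Next x y ⊎ Next y x
  ; adj-sym    = swap
  ; adj-irrefl = λ { (inj₁ e) → ¬Next-refl n≥3 e ; (inj₂ e) → ¬Next-refl n≥3 e }
  }

-- Cartesian (box) product, not the tensor product.
infixr 7 _×ᴳ_

_×ᴳ_ : Graph → Graph → Graph
G ×ᴳ H = record
  { V          = G.V × H.V
  ; Adj        = λ (g , h) (g′ , h′) →
                   (g ≡ g′ × H.Adj h h′) ⊎ (G.Adj g g′ × h ≡ h′)
  ; adj-sym    = λ { (inj₁ (e , a)) → inj₁ (sym e , H.adj-sym a)
                   ; (inj₂ (a , e)) → inj₂ (G.adj-sym a , sym e) }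
  ; adj-irrefl = λ { (inj₁ (_ , a)) → H.adj-irrefl a
                   ; (inj₂ (a , _)) → G.adj-irrefl a }
  }
  where
  module G = Graph G
  module H = Graph H

3≤4*k : ∀ {k} → 1 ≤ k → 3 ≤ 4 * k
3≤4*k k≥1 = ≤-trans (s≤s (s≤s (s≤s z≤n))) (*-monoʳ-≤ 4 k≥1)

[_⋯_] : ℕ → ℕ → Pred ℕ 0ℓ
[ a ⋯ b ] t = a ≤ t × t ≤ b

-- { r , 2r , … , dr }
Multiples : (d r : ℕ) → Pred ℕ 0ℓ
Multiples d r t = ∃[ i ] (i ∈ [ 1 ⋯ d ] × t ≡ i * r)

module _ (Γ : Graph) where
  open Graph Γ

  Differences : (V → ℕ) → Pred ℕ 0ℓ
  Differences f t = ∃[ x ] ∃[ y ] (Adj x y × ∣ f x - f y ∣ ≡ t)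

  -- The field q is determined by d, being the size of Γ divided by d.
  record IsDivisibleGraceful (d : ℕ) (f : V → ℕ) : Set where
    field
      q           : ℕ
      d-positive  : 1 ≤ d
      q-positive  : 1 ≤ q
      size        : HasSize Γ (d * q)
      injective   : Injective _≡_ _≡_ f
      bounded     : ∀ x → f x < d * (q + 1)
      differences : Differences f ≐ [ 1 ⋯ d * (q + 1) ] ∖ Multiples d (q + 1)

  record Bipartition : Set where
    field
      side   : V → Bool
      proper : ∀ {x y} → Adj x y → side x ≢ side y

    Part : Bool → Pred V 0ℓ
    Part b x = side x ≡ b

  IsMaximumOn : (V → ℕ) → Pred V 0ℓ → ℕ → Set
  IsMaximumOn f A M = (∃[ x ] (x ∈ A × f x ≡ M)) × (∀ x → x ∈ A → f x ≤ M)

  IsMinimumOn : (V → ℕ) → Pred V 0ℓ → ℕ → Set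
  IsMinimumOn f A μ = (∃[ x ] (x ∈ A × f x ≡ μ)) × (∀ x → x ∈ A → μ ≤ f x)

  record IsDivisibleGracefulAlpha (d : ℕ) (f : V → ℕ) : Set where
    field
      graceful    : IsDivisibleGraceful d f
      bipartition : Bipartition

    open Bipartition bipartition

    field
      separated : ∃[ b ] ∃[ M ] ∃[ μ ]
        (IsMaximumOn f (Part b) M × IsMinimumOn f (Part (not b)) μ × M < μ)

  AdmitsDivisibleGracefulAlphaLabeling : ℕ → Set
  AdmitsDivisibleGracefulAlphaLabeling d = ∃ (IsDivisibleGracefulAlpha d)

-- Write q = 2k, r = q + 1, R = 2r, and number the layers from 0 to m − 1.  The cycle C₄ₖ
-- has a 2-divisible graceful α-labeling z : z(2j) = 2k + j, raised by 2 when j ≥ k, and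
-- z(2j+1) = 2k − 1 − j; its edge from s to s + 1 gets a difference c(s), and c is a
-- bijection onto {1, …, R − 1} ∖ {r}.  Rotate layer i by i positions, so that the vertex
-- (p , i) sits at s = p + i mod 4k, and give it the label z(s) + (m − 1 ± i)R, with + for
-- even s and − for odd s.  Because of the rotation every edge of the grid, along a cycle or
-- between layers, joins s in a layer i to s + 1 in a layer j ∈ {i , i + 1}; its difference
-- is c(s) + (i + j)R, and i + j runs once through {0, …, 2m − 2}.  Hence each required
-- difference comes from exactly one edge, which also counts the edges.
module Submission where

open import Data.Bool.Base using (Bool; true; false)
open import Data.Fin.Base using (Fin; zero; suc; toℕ; fromℕ; fromℕ<; inject₁)
open import Data.Fin.Properties
  using (toℕ-injective; toℕ<n; toℕ≤pred[n]; toℕ-fromℕ; toℕ-fromℕ<; toℕ-inject₁; *↔×)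
open import Data.Fin.Relation.Unary.Top using (view; ‵fromℕ; ‵inject₁; view-fromℕ; view-inject₁)
open import Data.Nat.Base hiding (parity)
open import Data.Nat.DivMod
open import Data.Nat.Divisibility using (_∣_; divides; ∣m+n∣m⇒∣n; ∣m∣n⇒∣m+n)
open import Data.Nat.GeneralisedArithmetic using (fold)
open import Data.Nat.Properties
open import Data.Nat.Tactic.RingSolver using (solve-∀)
open import Data.Product.Base using (∃-syntax; ∃₂; _×_; _,_; proj₁; proj₂)
open import Data.Sum.Base using (_⊎_; inj₁; inj₂)
open import Function.Base using (_∘_)
open import Function.Bundles using (Inverse)
open import Function.Definitions using (Injective)
open import Relation.Binary.Definitions using (tri<; tri≈; tri>)
open import Relation.Binary.PropositionalEquality
open import Relation.Nullary.Decidable using (yes; no)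
open import Relation.Nullary.Negation using (¬_; contradiction)
open import Defs

-- Cyclic successor and predecessor

next : ∀ {n} → Fin (suc n) → Fin (suc n)
next s with view s
... | ‵fromℕ     = zero
... | ‵inject₁ i = suc i

prev : ∀ {n} → Fin (suc n) → Fin (suc n)
prev zero    = fromℕ _
prev (suc i) = inject₁ i

prev-next : ∀ {n} (s : Fin (suc n)) → prev (next s) ≡ s
prev-next s with view s
... | ‵fromℕ     = refl
... | ‵inject₁ i = refl

next-prev : ∀ {n} (s : Fin (suc n)) → next (prev s) ≡ s
next-prev {n} zero rewrite view-fromℕ n = refl
next-prev (suc i) rewrite view-inject₁ i = refl

Next-next : ∀ {n} (s : Fin (suc n)) → Next s (next s)
Next-next {n} s with view s
... | ‵fromℕ     = inj₂ (cong suc (toℕ-fromℕ n) , refl)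
... | ‵inject₁ i = inj₁ (cong suc (sym (toℕ-inject₁ i)))

Next⇒≡next : ∀ {n} {s t : Fin (suc n)} → Next s t → t ≡ next s
Next⇒≡next {n} {s} {t} s→t with view s | s→t
... | ‵fromℕ     | inj₁ e       =
  contradiction (trans e (cong suc (toℕ-fromℕ n))) (<⇒≢ (toℕ<n t))
... | ‵fromℕ     | inj₂ (_ , e) = toℕ-injective e
... | ‵inject₁ i | inj₁ e       = toℕ-injective (trans e (cong suc (toℕ-inject₁ i)))
... | ‵inject₁ i | inj₂ (e , _) =
  contradiction (trans (sym (toℕ-inject₁ i)) (suc-injective e)) (<⇒≢ (toℕ<n i))

-- Iterates of commuting and of inverse maps

module _ {A : Set} {f g : A → A} where

  fold-commute : (∀ x → f (g x) ≡ g (f x)) → ∀ i x → fold (g x) f i ≡ g (fold x f i)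
  fold-commute fg≡gf zero    x = refl
  fold-commute fg≡gf (suc i) x = trans (cong f (fold-commute fg≡gf i x)) (fg≡gf _)

  fold-inverse : (∀ x → f (g x) ≡ x) → ∀ i x → fold (fold x g i) f i ≡ x
  fold-inverse fg≡id zero    x = refl
  fold-inverse fg≡id (suc i) x =
    -- The outermost `f` is moved to the inside, where it meets and cancels the outermost `g`.
    trans (sym (fold-f i _)) (trans (cong (λ y → fold y f i) (fg≡id _)) (fold-inverse fg≡id i x))
    where
    fold-f : ∀ i y → fold (f y) f i ≡ f (fold y f i)
    fold-f zero    y = refl
    fold-f (suc i) y = cong f (fold-f i y)

-- Parity and division with remainder

data Halved : ℕ → Set where
  even : ∀ j → Halved (j * 2)
  odd  : ∀ j → Halved (suc (j * 2))

-- The view of `suc s` is computed from that of `s`, so facts about two consecutive cycle vertices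
-- need only one case split.
step : ∀ {s} → Halved s → Halved (suc s)
step (even j) = odd j
step (odd j)  = even (suc j)

halved : ∀ s → Halved s
halved zero    = even 0
halved (suc s) = step (halved s)

isEven : ∀ {s} → Halved s → Bool
isEven (even _) = true
isEven (odd _)  = false

1+i*2≢j*2 : ∀ {i j} → suc (i * 2) ≢ j * 2
1+i*2≢j*2 {i} {j} e = even≢odd j i
  (trans (*-comm 2 j) (trans (sym e) (cong suc (*-comm i 2))))

-- Reduction modulo `n` isolates `a`. With `n = R` this separates the cycle part from the layer
-- part, both in vertex labels and in edge differences.
+-*-unique : ∀ {a b i j n} .{{_ : NonZero n}} → a < n → b < n →
             a + i * n ≡ b + j * n → a ≡ b × i ≡ j
+-*-unique {a} {b} {i} {j} {n} a<n b<n e = a≡b , *-cancelʳ-≡ i j n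
    (+-cancelˡ-≡ a _ _ (trans e (cong (_+ j * n) (sym a≡b))))
  where
  remainder : ∀ {c} k → c < n → (c + k * n) % n ≡ c
  remainder {c} k c<n = trans ([m+kn]%n≡m%n c k n) (m<n⇒m%n≡m c<n)
  a≡b : a ≡ b
  a≡b = trans (sym (remainder i a<n)) (trans (cong (_% n) e) (remainder j b<n))

strict⇒injective : (h : ℕ → ℕ) → (∀ {a b} → a < b → h a < h b) → Injective _≡_ _≡_ h
strict⇒injective h h-mono {a} {b} e with <-cmp a b
... | tri< a<b _ _ = contradiction e (<⇒≢ (h-mono a<b))
... | tri≈ _ a≡b _ = a≡b
... | tri> _ _ b<a = contradiction (sym e) (<⇒≢ (h-mono b<a))

-- The labeling of a single cycle

module Label (k n′ : ℕ) (k≥1 : 1 ≤ k) (n≡ : suc n′ ≡ (k + k) * 2) where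

  q r R : ℕ
  q = k * 2
  r = q + 1
  R = 2 * r

  n≡q+q : suc n′ ≡ q + q
  n≡q+q = trans n≡ (*-distribʳ-+ 2 k k)

  gap : ℕ → ℕ
  gap t with t <? q
  ... | yes _ = 0
  ... | no  _ = 2

  gap-< : ∀ {t} → t < q → gap t ≡ 0
  gap-< {t} t<q with t <? q
  ... | yes _ = refl
  ... | no ≮  = contradiction t<q ≮

  gap-≥ : ∀ {t} → q ≤ t → gap t ≡ 2
  gap-≥ {t} q≤t with t <? q
  ... | yes t<q = contradiction q≤t (<⇒≱ t<q)
  ... | no _    = refl

  gap≤2 : ∀ t → gap t ≤ 2
  gap≤2 t with t <? q
  ... | yes _ = z≤n
  ... | no  _ = ≤-refl

  gap-mono : ∀ {s t} → s ≤ t → gap s ≤ gap t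
  gap-mono {s} {t} s≤t with s <? q | t <? q
  ... | yes _ | _       = z≤n
  ... | no s≮ | yes t<q = contradiction (≤-<-trans s≤t t<q) s≮
  ... | no _  | no _    = ≤-refl

  -- The threshold `q` is even, so `2j` and `2j + 1` lie on the same side of it.
  gap-odd : ∀ j → gap (suc (j * 2)) ≡ gap (j * 2)
  gap-odd j with j * 2 <? q
  ... | yes 2j<q = gap-< (≤∧≢⇒< 2j<q (1+i*2≢j*2 {j} {k}))
  ... | no  2j≮q = gap-≥ (m≤n⇒m≤1+n (≮⇒≥ 2j≮q))

  label : ∀ {s} → Halved s → ℕ
  label (even j) = q + (j + gap (j * 2))
  label (odd j)  = q ∸ suc j

  -- The increasing enumeration of the naturals other than `q` and `r = q + 1`.
  skip : ℕ → ℕ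
  skip t = t + gap t

  -- The edge closing the cycle receives `q`, the value missed by `skip` that must still occur.
  z c : Fin (suc n′) → ℕ
  z s = label (halved (toℕ s))
  c s with view s
  ... | ‵fromℕ     = q
  ... | ‵inject₁ i = skip (suc (toℕ i))

  parity : Fin (suc n′) → Bool
  parity s = isEven (halved (toℕ s))

  half-bound : ∀ j → j * 2 < suc n′ → j < q
  half-bound j 2j<n = *-cancelʳ-< 2 j q (<-≤-trans 2j<n (≤-reflexive
    (trans n≡q+q (trans (cong (q +_) (sym (+-identityʳ q))) (*-comm 2 q)))))

  Step : (s t : Fin (suc n′)) → Set
  Step s t = (parity s ≡ true  × parity t ≡ false × z s ≡ c s + z t)
           ⊎ (parity s ≡ false × parity t ≡ true  × z t ≡ c s + z s)

  -- The last vertex is `2j + 1` with `suc j = q`, where `q ∸ suc j` vanishes. The closing edge thus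
  -- joins label `0` to the label `q` of the first vertex.
  last-odd : ∀ {s} (h : Halved s) → suc s ≡ suc n′ → isEven h ≡ false × label h ≡ 0
  last-odd (even j) e = contradiction (trans e n≡) (1+i*2≢j*2 {j} {k + k})
  last-odd (odd j)  e = refl , m≤n⇒m∸n≡0 (≤-reflexive (sym 1+j≡q))
    where
    1+j≡q : suc j ≡ q
    1+j≡q = trans (*-cancelʳ-≡ (suc j) (k + k) 2 (trans e n≡))
                  (trans (cong (k +_) (sym (+-identityʳ k))) (*-comm 2 k))

  -- Since `j < q`, one can write `q = suc j + w` with `w = q ∸ suc j`. This removes the truncated
  -- subtraction and leaves linear identities.
  step-label : ∀ {s} (h : Halved s) → s < suc n′ →
    (isEven h ≡ true  × isEven (step h) ≡ false × label h ≡ skip (suc s) + label (step h))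
    ⊎ (isEven h ≡ false × isEven (step h) ≡ true  × label (step h) ≡ skip (suc s) + label h)
  step-label (even j) s<n = inj₁ (refl , refl , (begin
    q + (j + gap (j * 2))                ≡⟨ cong₂ (λ u v → u + (j + v))
                                              (sym (m+[n∸m]≡n (half-bound j s<n))) (sym (gap-odd j)) ⟩
    suc j + w + (j + gap (suc (j * 2)))  ≡⟨ rearrange j w _ ⟩
    suc (j * 2) + gap (suc (j * 2)) + w  ∎))
    where
    open ≡-Reasoning
    w : ℕ
    w = q ∸ suc j
    rearrange : ∀ j w g → suc j + w + (j + g) ≡ suc (j * 2) + g + w
    rearrange = solve-∀
  step-label (odd j) s<n = inj₂ (refl , refl , (begin
    q + (suc j + g)            ≡⟨ cong (_+ (suc j + g))
                                    (sym (m+[n∸m]≡n (half-bound j (<-trans (n<1+n _) s<n)))) ⟩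
    suc j + w + (suc j + g)    ≡⟨ rearrange j w g ⟩
    suc (suc (j * 2)) + g + w  ∎))
    where
    open ≡-Reasoning
    w g : ℕ
    w = q ∸ suc j
    g = gap (suc (suc (j * 2)))
    rearrange : ∀ j w g → suc j + w + (suc j + g) ≡ suc (suc (j * 2)) + g + w
    rearrange = solve-∀

  q≥1 : 1 ≤ q
  q≥1 = *-mono-≤ k≥1 (s≤s (z≤n {1}))

  label-0 : label (even 0) ≡ q
  label-0 = trans (cong (q +_) (gap-< q≥1)) (+-identityʳ q)

  next-Step : ∀ s → Step s (next s)
  next-Step s with view s
  ... | ‵inject₁ i rewrite toℕ-inject₁ i = step-label (halved (toℕ i)) (m<n⇒m<1+n (toℕ<n i))
  ... | ‵fromℕ     rewrite toℕ-fromℕ n′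
    with odd-last , zero-label ← last-odd (halved n′) refl =
    inj₂ (odd-last , refl , trans label-0 (sym (trans (cong (q +_) zero-label) (+-identityʳ q))))

  odd<even : ∀ {i j} → suc (j * 2) < suc n′ → label (odd j) < label (even i)
  odd<even {j = j} s<n = <-≤-trans
    (∸-monoʳ-< z<s (half-bound j (<-trans (n<1+n _) s<n))) (m≤m+n q _)

  label-injective : ∀ {s t} (g : Halved s) (h : Halved t) → s < suc n′ → t < suc n′ →
                    label g ≡ label h → s ≡ t
  label-injective (even i) (even j) _ _ e = cong (_* 2) (strict⇒injective (λ j → j + gap (j * 2))
    (λ a<b → +-mono-<-≤ a<b (gap-mono (*-monoˡ-≤ 2 (<⇒≤ a<b)))) (+-cancelˡ-≡ q _ _ e))
  label-injective (even i) (odd j)  _ t<n e = contradiction (sym e) (<⇒≢ (odd<even t<n))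
  label-injective (odd i)  (even j) s<n _ e = contradiction e (<⇒≢ (odd<even s<n))
  label-injective (odd i)  (odd j)  s<n t<n e = cong (λ j → suc (j * 2)) (suc-injective
    (∸-cancelˡ-≡ (half-bound i (<-trans (n<1+n _) s<n)) (half-bound j (<-trans (n<1+n _) t<n)) e))

  z-injective : Injective _≡_ _≡_ z
  z-injective {s} {t} e = toℕ-injective (label-injective (halved _) (halved _) (toℕ<n s) (toℕ<n t) e)

  R≡ : R ≡ 2 + (q + q)
  R≡ = rearrange q
    where
    rearrange : ∀ q → 2 * (q + 1) ≡ 2 + (q + q)
    rearrange = solve-∀

  instance
    R≢0 : NonZero R
    R≢0 = subst NonZero (sym R≡) _
    r≢0 : NonZero r
    r≢0 = subst NonZero (+-comm 1 q) _

  label<R : ∀ {s} (h : Halved s) → s < suc n′ → label h < R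
  label<R (even j) s<n = subst (q + (j + gap (j * 2)) <_) (trans (+-comm (q + q) 2) (sym R≡))
    (subst (_< q + q + 2) (+-assoc q j _)
      (+-mono-<-≤ (+-monoʳ-< q (half-bound j s<n)) (gap≤2 _)))
  label<R (odd j)  s<n = ≤-<-trans (m∸n≤m q (suc j))
    (subst (q <_) (sym R≡) (s≤s (m≤n⇒m≤1+n (m≤m+n q q))))

  z<R : ∀ s → z s < R
  z<R s = label<R (halved _) (toℕ<n s)

  skip-cases : ∀ t → (skip t ≡ t × t < q) ⊎ (skip t ≡ t + 2 × q ≤ t)
  skip-cases t with t <? q
  ... | yes t<q = inj₁ (+-identityʳ t , t<q)
  ... | no  t≮q = inj₂ (refl , ≮⇒≥ t≮q)

  r<t+2 : ∀ {t} → q ≤ t → r < t + 2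
  r<t+2 q≤t = +-mono-≤-< q≤t (n<1+n 1)

  skip≢q : ∀ t → skip t ≢ q
  skip≢q t e with skip-cases t
  ... | inj₁ (st , t<q) = <⇒≢ t<q (trans (sym st) e)
  ... | inj₂ (st , q≤t) = <⇒≢ (<-trans (≤-reflexive (+-comm 1 q)) (r<t+2 q≤t)) (trans (sym e) st)

  skip≢r : ∀ t → skip t ≢ r
  skip≢r t e with skip-cases t
  ... | inj₁ (st , t<q) = <⇒≢ (<-trans t<q (≤-reflexive (+-comm 1 q))) (trans (sym st) e)
  ... | inj₂ (st , q≤t) = <⇒≢ (r<t+2 q≤t) (trans (sym e) st)

  skip-injective : Injective _≡_ _≡_ skip
  skip-injective = strict⇒injective skip (λ a<b → +-mono-<-≤ a<b (gap-mono (<⇒≤ a<b)))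

  c-injective : Injective _≡_ _≡_ c
  c-injective {s} {t} e with view s | view t
  ... | ‵fromℕ     | ‵fromℕ     = refl
  ... | ‵fromℕ     | ‵inject₁ j = contradiction (sym e) (skip≢q _)
  ... | ‵inject₁ i | ‵fromℕ     = contradiction e (skip≢q _)
  ... | ‵inject₁ i | ‵inject₁ j =
    cong inject₁ (toℕ-injective (suc-injective (skip-injective e)))

  c-positive : ∀ s → 1 ≤ c s
  c-positive s with view s
  ... | ‵fromℕ     = q≥1
  ... | ‵inject₁ i = s≤s z≤n

  c≢r : ∀ s → c s ≢ r
  c≢r s with view s
  ... | ‵fromℕ     = <⇒≢ (≤-reflexive (+-comm 1 q))
  ... | ‵inject₁ i = skip≢r _

  c<R : ∀ s → c s < R
  c<R s with view s
  ... | ‵fromℕ     = subst (q <_) (sym R≡) (s≤s (m≤n⇒m≤1+n (m≤m+n q q)))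
  ... | ‵inject₁ i = subst (skip (suc (toℕ i)) <_) (trans (+-comm (q + q) 2) (sym R≡))
    (+-mono-<-≤ (subst (suc (toℕ i) <_) n≡q+q (s≤s (toℕ<n i))) (gap≤2 (suc (toℕ i))))

  c-skip : ∀ u → suc u < q + q → ∃[ s ] c s ≡ skip (suc u)
  c-skip u 1+u<2q = inject₁ i , value
    where
    u<n′ : u < n′
    u<n′ = s<s⁻¹ (subst (suc u <_) (sym n≡q+q) 1+u<2q)
    i : Fin n′
    i = fromℕ< u<n′
    value : c (inject₁ i) ≡ skip (suc u)
    value rewrite view-inject₁ i = cong (skip ∘ suc) (toℕ-fromℕ< u<n′)

  -- Values below `q` come from `skip t`, the value `q` from the closing edge, and values above `r`
  -- from `skip (t - 2)`.
  c-surjective : ∀ t → 1 ≤ t → t < R → t ≢ r → ∃[ s ] c s ≡ t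
  c-surjective t t≥1 t<R t≢r with <-cmp t q
  c-surjective (suc u) _ _ _ | tri< t<q _ _
    with s , e ← c-skip u (<-≤-trans t<q (m≤m+n q q)) =
    s , trans e (trans (cong (suc u +_) (gap-< t<q)) (+-identityʳ _))
  c-surjective t _ _ _ | tri≈ _ t≡q _ = fromℕ n′ , trans value (sym t≡q)
    where
    value : c (fromℕ n′) ≡ q
    value rewrite view-fromℕ n′ = refl
  c-surjective (suc zero) _ _ _ | tri> _ _ q<1 = contradiction q≥1 (<⇒≱ q<1)
  -- Here `q < 2` and `1 ≤ q` give `q = 1`, which would make the value `2` the excluded `r`.
  c-surjective (suc (suc zero)) _ _ t≢r | tri> _ _ q<2 =
    contradiction (trans (≤-antisym (s≤s q≥1) q<2) (+-comm 1 q)) t≢r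
  c-surjective (suc (suc (suc u))) _ t<R t≢r | tri> _ _ q<t
    with s , e ← c-skip u (s<s⁻¹ (s<s⁻¹ (subst (suc (suc (suc u)) <_) R≡ t<R))) =
    s , trans e (trans (cong (suc u +_) (gap-≥ q≤1+u)) (+-comm (suc u) 2))
    where
    q≤1+u : q ≤ suc u
    q≤1+u = s≤s⁻¹ (s≤s⁻¹ (≤∧≢⇒< q<t (λ e → t≢r (trans (sym e) (+-comm 1 q)))))

-- Rotated coordinates on the cylinder

module Cylinder (k n′ m′ : ℕ) (k≥1 : 1 ≤ k) (n≡ : suc n′ ≡ (k + k) * 2) (n≥3 : 3 ≤ suc n′) where

  open Label k n′ k≥1 n≡

  Γ : Graph
  Γ = C (suc n′) n≥3 ×ᴳ P (suc m′)

  open Graph Γ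

  D d : ℕ
  D = 2 * suc m′ ∸ 1
  d = 2 * D

  D≡ : D ≡ suc (m′ + m′)
  D≡ = trans (+-suc m′ (m′ + 0)) (cong (λ x → suc (m′ + x)) (+-identityʳ m′))

  position : V → Fin (suc n′)
  position (p , i) = fold p next (toℕ i)

  at : Fin (suc m′) → Fin (suc n′) → V
  at i s = fold s prev (toℕ i) , i

  position-at : ∀ i s → position (at i s) ≡ s
  position-at i s = fold-inverse next-prev (toℕ i) s

  at-position : ∀ x → at (proj₂ x) (position x) ≡ x
  at-position (p , i) = cong (_, i) (fold-inverse prev-next (toℕ i) p)

  Link : Fin (suc m′) → Fin (suc m′) → Set
  Link i j = i ≡ j ⊎ toℕ j ≡ suc (toℕ i)

  Forward : V → V → Set
  Forward x y = Link (proj₂ x) (proj₂ y) × position y ≡ next (position x)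

  next-commute : ∀ i p → fold (next {n′} p) next i ≡ next (fold p next i)
  next-commute = fold-commute (λ _ → refl)

  prev-commute : ∀ i p → fold (next {n′} p) prev i ≡ next (fold p prev i)
  prev-commute = fold-commute (λ s → trans (prev-next s) (sym (next-prev s)))

  -- Moving up one layer adds one more `next` to the rotation; moving along the cycle applies `next`
  -- before the rotation, with which it commutes.
  Adj⇒Forward : ∀ {x y} → Adj x y → Forward x y ⊎ Forward y x
  Adj⇒Forward {p , i} (inj₁ (refl , inj₁ e)) = inj₁ (inj₂ e , cong (fold p next) e)
  Adj⇒Forward {p , i} (inj₁ (refl , inj₂ e)) = inj₂ (inj₂ e , cong (fold p next) e)
  Adj⇒Forward {p , i} (inj₂ (inj₁ e , refl)) rewrite Next⇒≡next e =
    inj₁ (inj₁ refl , next-commute (toℕ i) _)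
  Adj⇒Forward {p , i} (inj₂ (inj₂ e , refl)) rewrite Next⇒≡next e =
    inj₂ (inj₁ refl , next-commute (toℕ i) _)

  -- Within a layer, `next` passes through the inverse rotation. Between layers, the additional
  -- `prev` of the upper layer cancels it.
  at-Adj : ∀ {i j} s → Link i j → Adj (at i s) (at j (next s))
  at-Adj {i} s (inj₁ refl) = inj₂ (inj₁
    (subst (Next _) (sym (prev-commute (toℕ i) s)) (Next-next _)) , refl)
  at-Adj {i} {j} s (inj₂ e) = inj₁ (sym (begin
    fold (next s) prev (toℕ j)        ≡⟨ cong (fold (next s) prev) e ⟩
    prev (fold (next s) prev (toℕ i)) ≡⟨ cong prev (prev-commute (toℕ i) s) ⟩
    prev (next (fold s prev (toℕ i))) ≡⟨ prev-next _ ⟩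
    fold s prev (toℕ i)               ∎) , inj₁ e)
    where open ≡-Reasoning

  -- Enumeration of the edges

  ⌈l/2⌉<m : (l : Fin D) → ⌈ toℕ l /2⌉ < suc m′
  ⌈l/2⌉<m l = s≤s (≤-trans (⌈n/2⌉-mono (s≤s⁻¹ (≤-trans (toℕ<n l) (≤-reflexive D≡))))
                            (≤-reflexive (sym (n≡⌈n+n/2⌉ m′))))

  ⌊l/2⌋<m : (l : Fin D) → ⌊ toℕ l /2⌋ < suc m′
  ⌊l/2⌋<m l = ≤-<-trans (⌊n/2⌋≤⌈n/2⌉ (toℕ l)) (⌈l/2⌉<m l)

  -- Two equal or consecutive layers are determined by the sum `l` of their indices, being its
  -- rounded halves; so `Fin D` enumerates the linked pairs.
  lower upper : Fin D → Fin (suc m′)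
  lower l = fromℕ< (⌊l/2⌋<m l)
  upper l = fromℕ< (⌈l/2⌉<m l)

  lower+upper : ∀ l → toℕ (lower l) + toℕ (upper l) ≡ toℕ l
  lower+upper l = trans (cong₂ _+_ (toℕ-fromℕ< (⌊l/2⌋<m l)) (toℕ-fromℕ< (⌈l/2⌉<m l)))
                        (⌊n/2⌋+⌈n/2⌉≡n (toℕ l))

  ⌊/2⌋-⌈/2⌉ : ∀ l → ⌊ l /2⌋ ≡ ⌈ l /2⌉ ⊎ ⌈ l /2⌉ ≡ suc ⌊ l /2⌋
  ⌊/2⌋-⌈/2⌉ zero          = inj₁ refl
  ⌊/2⌋-⌈/2⌉ (suc zero)    = inj₂ refl
  ⌊/2⌋-⌈/2⌉ (suc (suc l)) with ⌊/2⌋-⌈/2⌉ l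
  ... | inj₁ e = inj₁ (cong suc e)
  ... | inj₂ e = inj₂ (cong suc e)

  lower-upper : ∀ l → Link (lower l) (upper l)
  lower-upper l with ⌊/2⌋-⌈/2⌉ (toℕ l)
  ... | inj₁ e = inj₁ (toℕ-injective (trans (toℕ-fromℕ< _) (trans e (sym (toℕ-fromℕ< _)))))
  ... | inj₂ e = inj₂ (trans (toℕ-fromℕ< _) (trans e (cong suc (sym (toℕ-fromℕ< _)))))

  halves : ∀ i j → i ≡ j ⊎ j ≡ suc i → ⌊ i + j /2⌋ ≡ i × ⌈ i + j /2⌉ ≡ j
  halves i _ (inj₁ refl) = sym (n≡⌊n+n/2⌋ i) , sym (n≡⌈n+n/2⌉ i)
  -- `⌈ n /2⌉` is by definition `⌊ suc n /2⌋`, so for an odd sum the floor and ceiling facts about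
  -- `i + i` trade places.
  halves i _ (inj₂ refl) rewrite +-suc i i = sym (n≡⌈n+n/2⌉ i) , cong suc (sym (n≡⌊n+n/2⌋ i))

  Link⇒index : ∀ {i j} → Link i j → ∃[ l ] (lower l ≡ i × upper l ≡ j)
  Link⇒index {i} {j} i~j = l ,
    toℕ-injective (trans (toℕ-fromℕ< _) (trans (cong ⌊_/2⌋ (toℕ-fromℕ< _)) (proj₁ ij))) ,
    toℕ-injective (trans (toℕ-fromℕ< _) (trans (cong ⌈_/2⌉ (toℕ-fromℕ< _)) (proj₂ ij)))
    where
    toℕ-Link : Link i j → toℕ i ≡ toℕ j ⊎ toℕ j ≡ suc (toℕ i)
    toℕ-Link (inj₁ e) = inj₁ (cong toℕ e)
    toℕ-Link (inj₂ e) = inj₂ e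
    ij : ⌊ toℕ i + toℕ j /2⌋ ≡ toℕ i × ⌈ toℕ i + toℕ j /2⌉ ≡ toℕ j
    ij = halves (toℕ i) (toℕ j) (toℕ-Link i~j)
    l : Fin D
    l = fromℕ< (≤-<-trans (+-mono-≤ (toℕ≤pred[n] i) (toℕ≤pred[n] j)) (≤-reflexive (sym D≡)))

  -- The index `l` will be the quotient of the edge's difference by `R`, and `s` will determine the
  -- remainder.
  edge : Fin D × Fin (suc n′) → Edge Γ
  edge (l , s) = (at (lower l) s , at (upper l) (next s)) , at-Adj s (lower-upper l)

  Forward⇒edge : ∀ {x y} → Forward x y →
    ∃₂ λ l s → x ≡ at (lower l) s × y ≡ at (upper l) (next s)
  Forward⇒edge {x} {y} (i~j , e) with l , refl , refl ← Link⇒index i~j =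
    l , position x , sym (at-position x) , trans (sym (at-position y)) (cong (at _) e)

  edge-surjective : ∀ a → ∃[ u ] _≈ₑ_ Γ (edge u) a
  edge-surjective ((x , y) , x~y) with Adj⇒Forward x~y
  ... | inj₁ x→y with l , s , refl , refl ← Forward⇒edge x→y = (l , s) , inj₁ (refl , refl)
  ... | inj₂ y→x with l , s , refl , refl ← Forward⇒edge y→x = (l , s) , inj₂ (refl , refl)

  -- Labels and differences on the cylinder

  height : Bool → ℕ → ℕ
  height true  i = m′ + i
  height false i = m′ ∸ i

  level : Fin (suc n′) → Fin (suc m′) → ℕ
  level s i = z s + height (parity s) (toℕ i) * R

  f : V → ℕ
  f x = level (position x) (proj₂ x)

  f-at : ∀ i s → f (at i s) ≡ level s i
  f-at i s = cong (λ s → level s i) (position-at i s)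

  -- As `toℕ j ≤ m′`, one can write `m′ = w + toℕ j`. The label of the even endpoint is then the odd
  -- endpoint's label `y` plus the required difference.
  raised : ∀ a c {i} (j : Fin (suc m′)) →
    ∣ c + a + (m′ + i) * R - (a + (m′ ∸ toℕ j) * R) ∣ ≡ c + (i + toℕ j) * R
  raised a c {i} j = begin
    ∣ c + a + (m′ + i) * R - y ∣         ≡⟨ ∣-∣-comm (c + a + (m′ + i) * R) y ⟩
    ∣ y - c + a + (m′ + i) * R ∣         ≡⟨ cong (λ e → ∣ y - c + a + (e + i) * R ∣)
                                              (sym (m∸n+n≡m (toℕ≤pred[n] j))) ⟩
    ∣ y - c + a + (w + toℕ j + i) * R ∣  ≡⟨ cong (∣ y -_∣) (rearrange a c i (toℕ j) w R) ⟩
    ∣ y - y + (c + (i + toℕ j) * R) ∣    ≡⟨ ∣m-m+n∣≡n y _ ⟩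
    c + (i + toℕ j) * R                  ∎
    where
    open ≡-Reasoning
    w y : ℕ
    w = m′ ∸ toℕ j
    y = a + w * R
    rearrange : ∀ a c i j w R → c + a + (w + j + i) * R ≡ a + w * R + (c + (i + j) * R)
    rearrange = solve-∀

  level-difference : ∀ s i j → ∣ level s i - level (next s) j ∣ ≡ c s + (toℕ i + toℕ j) * R
  level-difference s i j with next-Step s
  ... | inj₁ (s-even , t-odd , e) rewrite s-even | t-odd | e = raised (z (next s)) (c s) j
  -- Now the even endpoint, which has the larger label, is `next s` in layer `j`, so the two layers
  -- exchange roles.
  ... | inj₂ (s-odd , t-even , e) rewrite s-odd | t-even | e =
    trans (∣-∣-comm (z s + _) _)
      (trans (raised (z s) (c s) i) (cong (λ l → c s + l * R) (+-comm (toℕ j) (toℕ i))))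

  difference : Edge Γ → ℕ
  difference ((x , y) , _) = ∣ f x - f y ∣

  difference-cong : ∀ a b → _≈ₑ_ Γ a b → difference a ≡ difference b
  difference-cong _ _ (inj₁ (refl , refl)) = refl
  difference-cong ((x , y) , _) _ (inj₂ (refl , refl)) = ∣-∣-comm (f x) (f y)

  difference-edge : ∀ l s → difference (edge (l , s)) ≡ c s + toℕ l * R
  difference-edge l s rewrite f-at (lower l) s | f-at (upper l) (next s) =
    trans (level-difference s (lower l) (upper l)) (cong (λ l → c s + l * R) (lower+upper l))

  -- The difference ignores orientation and already determines the index: modulo `R` its remainder
  -- is `c s`, its quotient is `l`, and `c` is injective.
  edge-injective : ∀ {u v} → _≈ₑ_ Γ (edge u) (edge v) → u ≡ v
  edge-injective {l , s} {l′ , s′} e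
    with cs≡ , l≡ ← +-*-unique (c<R s) (c<R s′) (trans (sym (difference-edge l s))
           (trans (difference-cong (edge (l , s)) (edge (l′ , s′)) e) (difference-edge l′ s′))) =
    cong₂ _,_ (toℕ-injective l≡) (c-injective cs≡)

  -- The number of edges

  hasSize : HasSize Γ (D * suc n′)
  hasSize = record
    { to        = edge ∘ to
    ; cong      = λ { refl → inj₁ (refl , refl) }
    ; bijective = (λ {x} {y} e → injective (edge-injective e)) , surjective
    }
    where
    open Inverse (*↔× {D} {suc n′}) using (to; from; strictlyInverseˡ; strictlyInverseʳ)
    injective : Injective _≡_ _≡_ to
    injective {x} {y} e =
      trans (sym (strictlyInverseʳ x)) (trans (cong from e) (strictlyInverseʳ y))
    surjective : ∀ a → ∃[ u ] (∀ {v} → v ≡ u → _≈ₑ_ Γ (edge (to v)) a)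
    surjective a with u , e ← edge-surjective a =
      from u , λ { refl → subst (λ w → _≈ₑ_ Γ (edge w) a) (sym (strictlyInverseˡ u)) e }

  size≡ : D * suc n′ ≡ d * q
  size≡ = trans (cong (D *_) n≡q+q) (rearrange D q)
    where
    rearrange : ∀ D q → D * (q + q) ≡ 2 * D * q
    rearrange = solve-∀

  d*r≡D*R : d * r ≡ D * R
  d*r≡D*R = rearrange D r
    where
    rearrange : ∀ D r → 2 * D * r ≡ D * (2 * r)
    rearrange = solve-∀

  -- Injectivity and range of the labeling

  height-injective : ∀ b {i j} → i ≤ m′ → j ≤ m′ → height b i ≡ height b j → i ≡ j
  height-injective true  _   _   e = +-cancelˡ-≡ m′ _ _ e
  height-injective false i≤m j≤m e = ∸-cancelˡ-≡ i≤m j≤m e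

  -- The remainder modulo `R` gives the position. Its parity fixes the sign in `height`, and the
  -- quotient then gives the layer.
  f-injective : Injective _≡_ _≡_ f
  f-injective {x} {y} e with +-*-unique (z<R (position x)) (z<R (position y)) e
  ... | z≡ , h≡ = trans (sym (at-position x)) (trans (cong₂ at i≡j s≡t) (at-position y))
    where
    s≡t : position x ≡ position y
    s≡t = z-injective z≡
    i≡j : proj₂ x ≡ proj₂ y
    i≡j = toℕ-injective (height-injective (parity (position x))
      (toℕ≤pred[n] (proj₂ x)) (toℕ≤pred[n] (proj₂ y))
      (trans h≡ (cong (λ s → height (parity s) (toℕ (proj₂ y))) (sym s≡t))))

  block-bound : ∀ {a i} → a < R → i < D → a + i * R < D * R
  block-bound {a} {i} a<R i<D = <-≤-trans (+-monoˡ-< (i * R) a<R) (*-monoˡ-≤ R i<D)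

  height<D : ∀ b {i} → i ≤ m′ → height b i < D
  height<D true      i≤m = ≤-trans (s≤s (+-monoʳ-≤ m′ i≤m)) (≤-reflexive (sym D≡))
  height<D false {i} i≤m = ≤-trans (s≤s (≤-trans (m∸n≤m m′ i) (m≤m+n m′ m′))) (≤-reflexive (sym D≡))

  f-bounded : ∀ x → f x < d * r
  f-bounded x = <-≤-trans (block-bound (z<R s) (height<D (parity s) (toℕ≤pred[n] (proj₂ x))))
    (≤-reflexive (sym d*r≡D*R))
    where s = position x

  -- The set of differences

  r∣R : ∀ i → r ∣ i * R
  r∣R i = divides (i * 2) (sym (*-assoc i 2 r))

  ∣⇒Multiples : ∀ {t} → 1 ≤ t → t ≤ d * r → r ∣ t → Multiples d r t
  ∣⇒Multiples t≥1 t≤dr (divides zero refl)      = contradiction t≥1 λ ()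
  ∣⇒Multiples t≥1 t≤dr (divides i@(suc _) refl) = i , (s≤s z≤n , *-cancelʳ-≤ i d r t≤dr) , refl

  r∣c⇒c≡r : ∀ {t} → 1 ≤ t → t < R → r ∣ t → t ≡ r
  r∣c⇒c≡r t≥1 t<R (divides zero refl)          = contradiction t≥1 λ ()
  r∣c⇒c≡r t≥1 t<R (divides (suc zero) refl)    = *-identityˡ r
  r∣c⇒c≡r t≥1 t<R (divides (suc (suc i)) refl) =
    contradiction (*-monoˡ-≤ r (s≤s (s≤s (z≤n {i})))) (<⇒≱ t<R)

  Allowed : ℕ → Set
  Allowed t = (1 ≤ t × t ≤ d * r) × ¬ Multiples d r t

  -- Since `R` is a multiple of `r`, divisibility by `r` depends only on `c s`, which lies strictly
  -- between `0` and `R` and differs from `r`.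
  edge-Allowed : ∀ l s → Allowed (c s + toℕ l * R)
  edge-Allowed l s =
    ( ≤-trans (c-positive s) (m≤m+n _ _)
    , ≤-trans (<⇒≤ (block-bound (c<R s) (toℕ<n l))) (≤-reflexive (sym d*r≡D*R))) ,
    λ (i , _ , e) → c≢r s (r∣c⇒c≡r (c-positive s) (c<R s)
      (∣m+n∣m⇒∣n (divides i (trans (+-comm (toℕ l * R) (c s)) e)) (r∣R (toℕ l))))

  -- Division of `t` by `R` gives `l` as quotient. The remainder is neither `0` nor `r`, because `r`
  -- does not divide `t`, so it is a value of `c`.
  Allowed⇒edge : ∀ {t} → Allowed t → ∃₂ λ l s → c s + toℕ l * R ≡ t
  Allowed⇒edge {t} ((t≥1 , t≤dr) , t∉) = fromℕ< t/R<D , proj₁ s ,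
    trans (cong₂ (λ a i → a + i * R) (proj₂ s) (toℕ-fromℕ< t/R<D)) (sym (m≡m%n+[m/n]*n t R))
    where
    r∤t : ¬ r ∣ t
    r∤t = t∉ ∘ ∣⇒Multiples t≥1 t≤dr
    r∤t%R : ¬ r ∣ t % R
    r∤t%R r∣ = r∤t (subst (r ∣_) (sym (m≡m%n+[m/n]*n t R)) (∣m∣n⇒∣m+n r∣ (r∣R (t / R))))
    t%R≥1 : 1 ≤ t % R
    t%R≥1 = n≢0⇒n>0 λ e → r∤t%R (divides 0 e)
    t%R≢r : t % R ≢ r
    t%R≢r e = r∤t%R (divides 1 (trans e (sym (*-identityˡ r))))
    s : ∃[ s ] c s ≡ t % R
    s = c-surjective (t % R) t%R≥1 (m%n<n t R) t%R≢r
    -- The upper end `d * r = D * R` of the range is itself a multiple of `r`; excluding it keeps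
    -- the quotient below `D`.
    t≢DR : t ≢ D * R
    t≢DR e = r∤t (subst (r ∣_) (sym e) (r∣R D))
    t/R<D : t / R < D
    t/R<D = m<n*o⇒m/o<n (≤∧≢⇒< (≤-trans t≤dr (≤-reflexive d*r≡D*R)) t≢DR)

  graceful : IsDivisibleGraceful Γ d f
  graceful = record
    { q           = q
    ; d-positive  = d≥1
    ; q-positive  = q≥1
    ; size        = subst (HasSize Γ) size≡ hasSize
    ; injective   = f-injective
    ; bounded     = f-bounded
    ; differences = Differences⊆Allowed , Allowed⊆Differences
    }
    where
    d≥1 : 1 ≤ d
    d≥1 = ≤-trans (subst (1 ≤_) (sym D≡) (s≤s z≤n)) (m≤m+n D (D + 0))
    Differences⊆Allowed : ∀ {t} → Differences Γ f t → Allowed t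
    Differences⊆Allowed (x , y , x~y , refl) with (l , s) , e ← edge-surjective ((x , y) , x~y) =
      subst Allowed
        (trans (sym (difference-edge l s)) (difference-cong (edge (l , s)) ((x , y) , x~y) e))
        (edge-Allowed l s)
    Allowed⊆Differences : ∀ {t} → Allowed t → Differences Γ f t
    Allowed⊆Differences t-allowed with l , s , refl ← Allowed⇒edge t-allowed =
      _ , _ , proj₂ (edge (l , s)) , difference-edge l s

  -- Bipartition and separation of the labels

  parity-next : ∀ s → parity (next s) ≢ parity s
  parity-next s e with next-Step s
  ... | inj₁ (s-even , t-odd , _) = contradiction (trans (sym s-even) (trans (sym e) t-odd)) λ ()
  ... | inj₂ (s-odd , t-even , _) = contradiction (trans (sym t-even) (trans e s-odd)) λ ()

  bipartition : Bipartition Γ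
  bipartition = record { side = parity ∘ position ; proper = proper }
    where
    proper : ∀ {x y} → Adj x y → parity (position x) ≢ parity (position y)
    proper x~y e with Adj⇒Forward x~y
    ... | inj₁ (_ , y≡) = parity-next _ (trans (cong parity (sym y≡)) (sym e))
    ... | inj₂ (_ , x≡) = parity-next _ (trans (cong parity (sym x≡)) e)

  odd-label : ∀ {s} (h : Halved s) → isEven h ≡ false → label h ≤ q ∸ 1
  odd-label (odd j) refl = ∸-monoʳ-≤ q (s≤s z≤n)

  even-label : ∀ {s} (h : Halved s) → isEven h ≡ true → q ≤ label h
  even-label (even j) refl = m≤m+n q _

  alpha : IsDivisibleGracefulAlpha Γ d f
  alpha = record
    { graceful    = graceful
    ; bipartition = bipartition
    -- Both extremes occur in layer `0`, where the height is `m′`: odd heights decrease from there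
    -- and even heights increase. Positions `1` and `0` carry the cycle labels `q ∸ 1` and `q`.
    ; separated   = false , q ∸ 1 + m′ * R , q + m′ * R ,
        (((one , zero) , one-odd , one-level) , odd-≤) ,
        (((zero , zero) , refl , cong₂ (λ a b → a + b * R) label-0 (+-identityʳ m′)) , even-≥) ,
        +-monoˡ-< (m′ * R) (∸-monoʳ-< (s≤s z≤n) q≥1)
    }
    where
    open Bipartition bipartition using (side)
    1<n : 1 < suc n′
    1<n = ≤-trans (s≤s (s≤s z≤n)) n≥3
    one : Fin (suc n′)
    one = fromℕ< 1<n
    one-odd : parity one ≡ false
    one-odd = cong (isEven ∘ halved) (toℕ-fromℕ< 1<n)
    one-level : f (one , zero) ≡ q ∸ 1 + m′ * R
    one-level rewrite one-odd = cong (_+ m′ * R) (cong (label ∘ halved) (toℕ-fromℕ< 1<n))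
    odd-≤ : ∀ x → side x ≡ false → f x ≤ q ∸ 1 + m′ * R
    odd-≤ x x-odd rewrite x-odd =
      +-mono-≤ (odd-label (halved _) x-odd) (*-monoˡ-≤ R (m∸n≤m m′ (toℕ (proj₂ x))))
    even-≥ : ∀ x → side x ≡ true → q + m′ * R ≤ f x
    even-≥ x x-even rewrite x-even =
      +-mono-≤ (even-label (halved _) x-even) (*-monoˡ-≤ R (m≤m+n m′ (toℕ (proj₂ x))))

theorem3p3 : (k m : ℕ) (k≥1 : 1 ≤ k) → 2 ≤ m →
    AdmitsDivisibleGracefulAlphaLabeling (C (4 * k) (3≤4*k k≥1) ×ᴳ P m) (2 * (2 * m ∸ 1))
theorem3p3 k@(suc _) (suc m′) k≥1 _ = f , alpha
  where
  4k≡ : ∀ k → 4 * k ≡ (k + k) * 2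
  4k≡ = solve-∀
  -- With `k` matched as a successor, `4 * k` reduces to a successor, and this determines the
  -- argument `_`.
  open Cylinder k _ m′ k≥1 (4k≡ k) (3≤4*k k≥1)
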